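{- Let $A$ be a finite set with $|A|\ge 2$ and let $n\ge 2$. The maximum, over all permutations $f$ of $A^n$ (bijections $A^n\to A^n$), of the procedural complexity $\mathcal{L}(f)$ is exactly $2n-1$.
   Context: A transformation of $A^n$ is a map $f=(f_1,\dots,f_n):A^n\to A^n$; its coordinate function $f_i:A^n\to A$ is trivial if $f_i(x)=x_i$ for all $x$. An instruction is a transformation of $A^n$ with at most one nontrivial coordinate function. A program of length $L$ computing $f$ is a sequence of instructions $g^1,\dots,g^L$ with $f=g^L\circ\cdots\circ g^1$. The procedural complexity $\mathcal{L}(f)$ is the shortest length of a program computing $f$; the identity has procedural complexity $0$. -}

module Defs where

open import Level using (Level)
open import Data.Nat using (ℕ; _≤_)
open import Data.Fin using (Fin)
open import Data.Vec using (Vec; lookup)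
open import Data.List using (List; []; _∷_; length)
open import Data.Product using (Σ; ∃-syntax; _×_; proj₁)
open import Function using (id; _∘_)
open import Function.Definitions using (Bijective)
open import Relation.Nullary using (¬_)
open import Relation.Binary.PropositionalEquality using (_≡_; _≗_)

private
  variable
    a : Level
    A : Set a
    n : ℕ

Transformation : Set a → ℕ → Set a
Transformation A n = Vec A n → Vec A n

coordinate : Transformation A n → Fin n → Vec A n → A
coordinate f i x = lookup (f x) i

Trivial : Transformation A n → Fin n → Set _
Trivial {A = A} {n = n} f i = (x : Vec A n) → coordinate f i x ≡ lookup x i

IsInstruction : Transformation A n → Set _
IsInstruction {n = n} f =
  (i j : Fin n) → ¬ Trivial f i → ¬ Trivial f j → i ≡ j

Instruction : Set a → ℕ → Set a
Instruction A n = Σ (Transformation A n) IsInstruction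

Program : Set a → ℕ → Set a
Program A n = List (Instruction A n)

-- The head of the list is the instruction executed first.
run : Program A n → Transformation A n
run []      = id
run (g ∷ p) = run p ∘ proj₁ g

Computes : Program A n → Transformation A n → Set _
Computes p f = run p ≗ f

-- A relation rather than a function, since a minimum need not exist for
-- arbitrary A and f.
ProceduralComplexity : Transformation A n → ℕ → Set _
ProceduralComplexity {A = A} {n = n} f L =
  (∃[ p ] (Computes {A = A} {n = n} p f × length p ≡ L)) ×
  ((p : Program A n) → Computes p f → L ≤ length p)

IsPermutation : Transformation A n → Set _
IsPermutation f = Bijective _≡_ _≡_ f

-- The first component also asserts that the complexity of every permutation
-- is defined, so that the maximum ranges over all of them.
MaxComplexityOfPermutations : Set a → ℕ → ℕ → Set a
MaxComplexityOfPermutations A n M =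
  ((f : Transformation A n) → IsPermutation f →
     ∃[ L ] (ProceduralComplexity f L × L ≤ M)) ×
  (∃[ f ] (IsPermutation {A = A} {n = n} f × ProceduralComplexity f M))

{-# OPTIONS --safe #-}
module Submission where

-- Upper bound: join the last n − 1 coordinates of x to those of f x, for every x. This is a |A|-regular
-- bipartite multigraph, which has a proper edge colouring with |A| colours (König). Write the colour of x
-- into the first coordinate; then, for each colour, the other coordinates are permuted, which takes
-- 2(n − 1) − 1 instructions by induction; finally restore the first coordinate.
--
-- Lower bound: if at most 2n − 2 instructions compute f, the first half leaves some coordinate j alone
-- and the second half some coordinate i, so that the bijection g computed by the first half has
-- g(x)ᵢ = f(x)ᵢ and g(x)ⱼ = xⱼ. No such g exists when f transposes two points which differ in every coordinate.

open import Defs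
open import Level using (Level; _⊔_)
open import Data.Nat using (ℕ; zero; suc; _+_; _≤_; _<_; _*_; _∸_; z≤n; s≤s)
open import Data.Fin using (Fin; zero; suc; punchOut)
import Data.Fin.Properties as Fin
import Data.Nat.Properties as ℕ
open import Data.List using ([]; _∷_; _++_; length; take; drop)
import Data.List.Properties as List
open import Data.Vec as Vec using (Vec; []; _∷_; _∷ʳ_; lookup; replicate; _[_]≔_)
import Data.Vec.Properties as Vec
open import Data.Product using (∃; ∃₂; ∃-syntax; _×_; _,_; proj₁; proj₂)
open import Data.Product.Function.NonDependent.Propositional using (_×-↔_)
open import Data.Sum using (_⊎_; inj₁; inj₂)
open import Function using (id; _∘_)
open import Function.Bundles using (_↔_; mk↔ₛ′; module Inverse)
open import Function.Definitions using (Injective)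
open import Function.Properties.Inverse using (↔-refl; ↔-sym; ↔-trans; ↔⇒↣)
open import Relation.Binary.Definitions using (DecidableEquality; Reflexive; Transitive)
import Relation.Binary.Definitions as B
open import Relation.Binary.Core using (Rel)
open import Relation.Binary.Construct.Closure.ReflexiveTransitive using (Star; ε; _◅_; _◅◅_)
open import Relation.Binary.PropositionalEquality
  using (_≡_; _≢_; _≗_; refl; sym; trans; cong; cong₂; subst; module ≡-Reasoning)
open import Relation.Nullary using (¬_; Dec; yes; no; contradiction)
open import Relation.Nullary.Decidable using (map′; _×-dec_; _⊎-dec_; via-injection; decidable-stable; ¬?)
open import Relation.Unary using (Decidable)

private
  variable
    a p q r s : Level
    A X : Set a
    m n : ℕ

-- Exchanging two elements

module Transposition {A : Set a} (_≟_ : DecidableEquality A) where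

  swap : A → A → A → A
  swap x y z with z ≟ x | z ≟ y
  ... | yes _ | _     = y
  ... | no  _ | yes _ = x
  ... | no  _ | no  _ = z

  swap-left : ∀ x y → swap x y x ≡ y
  swap-left x y with x ≟ x | x ≟ y
  ... | yes _   | _ = refl
  ... | no  x≢x | _ = contradiction refl x≢x

  swap-right : ∀ x y → swap x y y ≡ x
  swap-right x y with y ≟ x | y ≟ y
  ... | yes y≡x | _       = y≡x
  ... | no  _   | yes _   = refl
  ... | no  _   | no  y≢y = contradiction refl y≢y

  swap-other : ∀ {x y z} → z ≢ x → z ≢ y → swap x y z ≡ z
  swap-other {x} {y} {z} z≢x z≢y with z ≟ x | z ≟ y
  ... | yes z≡x | _       = contradiction z≡x z≢x
  ... | no  _   | yes z≡y = contradiction z≡y z≢y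
  ... | no  _   | no  _   = refl

  swap-involutive : ∀ x y z → swap x y (swap x y z) ≡ z
  swap-involutive x y z with z ≟ x | z ≟ y
  ... | yes refl | _        = swap-right x y
  ... | no  _    | yes refl = swap-left x y
  ... | no  z≢x  | no  z≢y  = swap-other z≢x z≢y

  swap-injective : ∀ x y → Injective _≡_ _≡_ (swap x y)
  swap-injective x y {u} {v} eq =
    trans (sym (swap-involutive x y u)) (trans (cong (swap x y) eq) (swap-involutive x y v))

-- Finite sets

Finite : Set a → Set a
Finite X = ∃[ k ] (X ↔ Fin k)

Fin-finite : Finite (Fin n)
Fin-finite {n} = n , ↔-refl

×-finite : {X : Set p} {Y : Set q} → Finite X → Finite Y → Finite (X × Y)
×-finite (_ , e) (_ , e′) = _ , ↔-trans (e ×-↔ e′) (↔-sym Fin.*↔×)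

head∷tail : (xs : Vec X (suc n)) → Vec.head xs ∷ Vec.tail xs ≡ xs
head∷tail (_ ∷ _) = refl

abstract
  Vec-finite : Finite X → ∀ n → Finite (Vec X n)
  Vec-finite fin zero    = 1 , mk↔ₛ′ (λ _ → zero) (λ _ → []) (λ { zero → refl }) (λ { [] → refl })
  Vec-finite fin (suc n) with ×-finite fin (Vec-finite fin n)
  ... | k , e = k , ↔-trans (mk↔ₛ′ (λ xs → Vec.head xs , Vec.tail xs) (λ (x , xs) → x ∷ xs)
                                  (λ _ → refl) head∷tail) e

-- If `y` were missed, punching it out of the codomain would inject `Fin (suc n)` into `Fin n`.
Fin-injective⇒surjective : (f : Fin n → Fin n) → Injective _≡_ _≡_ f → ∀ y → ∃[ x ] f x ≡ y
Fin-injective⇒surjective {suc n} f inj y with Fin.any? (λ x → f x Fin.≟ y)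
... | yes hit  = hit
... | no  miss = contradiction
  (Fin.injective⇒≤ {f = λ x → punchOut (y≢f x)} (λ {x} {x′} eq → inj (Fin.punchOut-injective (y≢f x) (y≢f x′) eq)))
  ℕ.1+n≰n
  where
  y≢f : ∀ x → y ≢ f x
  y≢f x y≡fx = miss (x , sym y≡fx)

module Finiteness {X : Set a} (fin : Finite X) where
  open Inverse (proj₂ fin)

  private
    from-injective : Injective _≡_ _≡_ from
    from-injective {i} {j} eq = trans (sym (strictlyInverseˡ i)) (trans (cong to eq) (strictlyInverseˡ j))

    to-injective : Injective _≡_ _≡_ to
    to-injective {x} {y} eq = trans (sym (strictlyInverseʳ x)) (trans (cong from eq) (strictlyInverseʳ y))

  decEq : DecidableEquality X
  decEq = via-injection (↔⇒↣ (proj₂ fin)) Fin._≟_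

  any? : {P : X → Set p} → Decidable P → Dec (∃ P)
  any? {P = P} P? = map′
    (λ { (i , pi) → from i , pi })
    (λ { (x , px) → to x , subst P (sym (strictlyInverseʳ x)) px })
    (Fin.any? (P? ∘ from))

  all? : {P : X → Set p} → Decidable P → Dec (∀ x → P x)
  all? {P = P} P? = map′
    (λ all x → subst P (strictlyInverseʳ x) (all (to x)))
    (λ all i → all (from i))
    (Fin.all? (P? ∘ from))

  injective⇒surjective : {f : X → X} → Injective _≡_ _≡_ f → ∀ y → ∃[ x ] f x ≡ y
  injective⇒surjective {f} inj y
    with i , eq ← Fin-injective⇒surjective (to ∘ f ∘ from) (from-injective ∘ inj ∘ to-injective) (to y)
    = from i , to-injective eq

  -- A choice `g` of preimages is injective, hence surjective by finiteness, so it is a two-sided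
  -- inverse of `f`.
  surjective⇒injective : {f : X → X} → (∀ y → ∃[ x ] f x ≡ y) → Injective _≡_ _≡_ f
  surjective⇒injective {f} sur {x} {x′} eq =
    trans (sym (section x)) (trans (cong g eq) (section x′))
    where
    g : X → X
    g y = proj₁ (sur y)

    g-injective : Injective _≡_ _≡_ g
    g-injective {y} {y′} gy≡gy′ = trans (sym (proj₂ (sur y))) (trans (cong f gy≡gy′) (proj₂ (sur y′)))

    section : ∀ x → g (f x) ≡ x
    section x with y , refl ← injective⇒surjective g-injective x = cong g (proj₂ (sur y))

  -- Pigeonhole: an injective `f` would be surjective. The pair is found by exhaustive search.
  collision : (f : X → X) (y : X) → (∀ x → f x ≢ y) → ∃₂ λ x x′ → x ≢ x′ × f x ≡ f x′
  collision f y missed with any? (λ x → any? (λ x′ → ¬? (decEq x x′) ×-dec decEq (f x) (f x′)))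
  ... | yes found = found
  ... | no  none  = contradiction (proj₂ (injective⇒surjective inj y)) (missed _)
    where
    inj : Injective _≡_ _≡_ f
    inj {x} {x′} eq = decidable-stable (decEq x x′) (λ x≢x′ → none (x , x′ , x≢x′ , eq))

  -- Decidability of reachability in a finite graph

  module _ {_⇒_ : Rel X r} (_⇒?_ : B.Decidable _⇒_) where

    private
      -- Floyd–Warshall: a non-empty path whose intermediate vertices are values of the enumeration.
      data Path : ∀ {k} → (Fin k → X) → Rel X (a ⊔ r) where
        edge : ∀ {v x y} → x ⇒ y → Path {zero} v x y
        skip : ∀ {k} {v : Fin (suc k) → X} {x y} → Path (v ∘ suc) x y → Path v x y
        via  : ∀ {k} {v : Fin (suc k) → X} {x y} →
               Path (v ∘ suc) x (v zero) → Path (v ∘ suc) (v zero) y → Path v x y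

      path? : ∀ {k} (v : Fin k → X) → B.Decidable (Path v)
      path? {zero}  v x y = map′ edge (λ { (edge e) → e }) (x ⇒? y)
      path? {suc k} v x y = map′
        (λ { (inj₁ l) → skip l ; (inj₂ (l , r)) → via l r })
        (λ { (skip l) → inj₁ l ; (via l r) → inj₂ (l , r) })
        (path? (v ∘ suc) x y ⊎-dec path? (v ∘ suc) x (v zero) ×-dec path? (v ∘ suc) (v zero) y)

      from-edge : ∀ {k} (v : Fin k → X) {x y} → x ⇒ y → Path v x y
      from-edge {zero}  v e = edge e
      from-edge {suc k} v e = skip (from-edge (v ∘ suc) e)

      into-first : ∀ {k} {v : Fin (suc k) → X} {x} → Path v x (v zero) → Path (v ∘ suc) x (v zero)
      into-first (skip l)  = l
      into-first (via l _) = l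

      from-first : ∀ {k} {v : Fin (suc k) → X} {y} → Path v (v zero) y → Path (v ∘ suc) (v zero) y
      from-first (skip l)  = l
      from-first (via _ l) = l

      -- The meeting point `v i` is in the enumeration, so it may become an intermediate vertex. If
      -- both pieces already pass through `v zero`, the excursion between the two visits is cut out.
      join : ∀ {k} {v : Fin k → X} {x y} (i : Fin k) → Path v x (v i) → Path v (v i) y → Path v x y
      join zero    l          r          = via (into-first l) (from-first r)
      join (suc i) (skip l)   (skip r)   = skip (join i l r)
      join (suc i) (skip l)   (via r r′) = via (join i l r) r′
      join (suc i) (via l l′) (skip r)   = via l (join i l′ r)
      join (suc i) (via l _)  (via _ r)  = via l r

      sound : ∀ {k} {v : Fin k → X} {x y} → Path v x y → Star _⇒_ x y
      sound (edge e)  = e ◅ ε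
      sound (skip l)  = sound l
      sound (via l r) = sound l ◅◅ sound r

      complete : ∀ {x y} → Star _⇒_ x y → x ≡ y ⊎ Path from x y
      complete ε = inj₁ refl
      complete (_◅_ {j = z} e es) with complete es
      ... | inj₁ refl = inj₂ (from-edge from e)
      ... | inj₂ l    = inj₂ (join′ z (from-edge from e) l)
        where
        join′ : ∀ {x y} z → Path from x z → Path from z y → Path from x y
        join′ {x} {y} z l r = join (to z)
          (subst (Path from x) (sym (strictlyInverseʳ z)) l)
          (subst (λ u → Path from u y) (sym (strictlyInverseʳ z)) r)

    abstract
      Star? : B.Decidable (Star _⇒_)
      Star? x y = map′
        (λ { (inj₁ refl) → ε ; (inj₂ l) → sound l })
        complete
        (decEq x y ⊎-dec path? from x y)

-- `Star` exposes the first step of a path; `preceded` needs the one by which it arrives.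
last-step : {_⇒_ : Rel X r} → ∀ {x y} → Star _⇒_ x y → x ≡ y ⊎ ∃[ z ] (Star _⇒_ x z × z ⇒ y)
last-step ε = inj₁ refl
last-step (e ◅ es) with last-step es
... | inj₁ refl            = inj₂ (_ , ε , e)
... | inj₂ (z , es′ , e′) = inj₂ (z , e ◅ es′ , e′)

-- Monotone improvement over a finite set

module _ {S : Set s} (_⟶_ : Rel S r) (⟶-refl : Reflexive _⟶_) (⟶-trans : Transitive _⟶_) where

  private
    Fin-sweep : ∀ n (P : S → Fin n → Set p) → (∀ {s s′} i → s ⟶ s′ → P s i → P s′ i) →
                (∀ s i → ∃[ s′ ] (s ⟶ s′ × P s′ i)) → ∀ s → ∃[ s′ ] (s ⟶ s′ × (∀ i → P s′ i))
    Fin-sweep zero    P mono step s = s , ⟶-refl , λ ()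
    Fin-sweep (suc n) P mono step s
      with s′ , s⟶s′ , all ← Fin-sweep n (λ s → P s ∘ suc) (mono ∘ suc) (λ s i → step s (suc i)) s
      with s″ , s′⟶s″ , p₀ ← step s′ zero
      = s″ , ⟶-trans s⟶s′ s′⟶s″ , λ { zero → p₀ ; (suc i) → mono (suc i) s′⟶s″ (all i) }

  -- The elements are treated one after another, and monotonicity keeps what was achieved earlier.
  -- This serves twice: for the colours at a right vertex, and for the right vertices.
  sweep : Finite X → (P : S → X → Set p) → (∀ {s s′} x → s ⟶ s′ → P s x → P s′ x) →
          (∀ s x → ∃[ s′ ] (s ⟶ s′ × P s′ x)) → ∀ s → ∃[ s′ ] (s ⟶ s′ × (∀ x → P s′ x))
  sweep (k , e) P mono step s
    with s′ , s⟶s′ , all ← Fin-sweep k (λ s → P s ∘ Inverse.from e) (mono ∘ Inverse.from e) (λ s i → step s (Inverse.from e i)) s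
    = s′ , s⟶s′ , λ x → subst (P s′) (strictlyInverseʳ x) (all (to x))
    where open Inverse e

-- König's edge-colouring theorem

-- The elements of X are the edges of a bipartite multigraph between T and R; the edges at v : R
-- include the distinct ones slot v γ, of which there are as many as there are colours.
module Colouring
  {X T R C : Set a} (X-finite : Finite X) (T-finite : Finite T) (R-finite : Finite R) (C-finite : Finite C)
  (left : X → T) (right : X → R)
  (slot : R → C → X) (slot-injective : ∀ v → Injective _≡_ _≡_ (slot v)) (right-slot : ∀ v γ → right (slot v γ) ≡ v)
  where

  private
    module X = Finiteness X-finite
    module T = Finiteness T-finite
    module C = Finiteness C-finite

  -- Properness is maintained at left ends only; at a right vertex the aim is that every colour
  -- occurs. If it has exactly as many edges as there are colours, this means properness there too.
  LeftProper : (X → C) → Set a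
  LeftProper c = ∀ {x y} → left x ≡ left y → c x ≡ c y → x ≡ y

  Present : (X → C) → R → C → Set a
  Present c v γ = ∃[ x ] (right x ≡ v × c x ≡ γ)

  Complete : (X → C) → R → Set a
  Complete c v = ∀ γ → Present c v γ

  -- A Kempe exchange: α and β are exchanged at the left vertices of Z, where Z is what can be reached from
  -- the left end of x₀ by paths β, α, β, α, … The path cannot come back through x₁, because v has no β-edge.
  module Exchange
    {c : X → C} (proper : LeftProper c) {v : R} {β : C} (missing : ¬ Present c v β)
    {x₀ x₁ : X} (x₀≢x₁ : x₀ ≢ x₁) (right-x₀ : right x₀ ≡ v) (right-x₁ : right x₁ ≡ v) (same : c x₀ ≡ c x₁)
    where

    open Transposition C.decEq

    private
      α : C
      α = c x₀

      -- A step follows the β-edge `y` at `t` and returns along an α-edge `x` with the same right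
      -- end. The colouring need not be proper on the right, so there may be several such `x`; all
      -- are followed.
      _⇒_ : Rel T a
      t ⇒ t′ = ∃₂ λ y x → left y ≡ t × c y ≡ β × left x ≡ t′ × c x ≡ α × right x ≡ right y

      _⇒?_ : B.Decidable _⇒_
      t ⇒? t′ = X.any? λ y → X.any? λ x →
        T.decEq (left y) t ×-dec C.decEq (c y) β ×-dec
        T.decEq (left x) t′ ×-dec C.decEq (c x) α ×-dec Finiteness.decEq R-finite (right x) (right y)

      Z : T → Set a
      Z = Star _⇒_ (left x₀)

      Z? : Decidable Z
      Z? = T.Star? _⇒?_ (left x₀)

      exchange : X → C
      exchange x with Z? (left x)
      ... | yes _ = swap α β (c x)
      ... | no  _ = c x

      exchange-in : ∀ {x γ} → Z (left x) → c x ≡ γ → exchange x ≡ swap α β γ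
      exchange-in {x} z refl with Z? (left x)
      ... | yes _  = refl
      ... | no  ¬z = contradiction z ¬z

      exchange-out : ∀ {x γ} → ¬ Z (left x) → c x ≡ γ → exchange x ≡ γ
      exchange-out {x} ¬z refl with Z? (left x)
      ... | yes z = contradiction z ¬z
      ... | no  _ = refl

      exchange-other : ∀ {x γ} → γ ≢ α → γ ≢ β → c x ≡ γ → exchange x ≡ γ
      exchange-other {x} γ≢α γ≢β refl with Z? (left x)
      ... | yes _ = swap-other γ≢α γ≢β
      ... | no  _ = refl

      exchange-proper : LeftProper exchange
      exchange-proper {x} {y} l≡ eq with Z? (left x) | Z? (left y)
      ... | yes _  | yes _  = proper l≡ (swap-injective α β eq)
      ... | yes z  | no  ¬z = contradiction (subst Z l≡ z) ¬z
      ... | no  ¬z | yes z  = contradiction (subst Z (sym l≡) z) ¬z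
      ... | no  _  | no  _  = proper l≡ eq

      -- The last step of the path arrives along an α-edge at `left x`, which is `x` by properness,
      -- and had set out along a β-edge with the same right end. The empty path gives `x₀` instead.
      preceded : ∀ {x} → c x ≡ α → Z (left x) → x₀ ≡ x ⊎ ∃[ y ] (right y ≡ right x × c y ≡ β × Z (left y))
      preceded cx≡α z with last-step z
      ... | inj₁ l≡ = inj₁ (proper l≡ (sym cx≡α))
      ... | inj₂ (_ , z′ , y , x′ , refl , cy≡β , lx′≡lx , cx′≡α , r≡)
        with refl ← proper lx′≡lx (trans cx′≡α (sym cx≡α)) = inj₂ (y , sym r≡ , cy≡β , z′)

      x₁∉Z : ¬ Z (left x₁)
      x₁∉Z z with preceded (sym same) z
      ... | inj₁ x₀≡x₁              = x₀≢x₁ x₀≡x₁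
      ... | inj₂ (y , r≡ , cy≡β , _) = missing (y , trans r≡ right-x₁ , cy≡β)

      present-β : Present exchange v β
      present-β = x₀ , right-x₀ , trans (exchange-in ε refl) (swap-left α β)

      present-mono : ∀ γ → Present c v γ → Present exchange v γ
      present-mono γ (x , r≡ , cx≡γ) with C.decEq γ α | C.decEq γ β
      ... | yes refl | _        = x₁ , right-x₁ , exchange-out x₁∉Z (sym same)
      ... | no  _    | yes refl = present-β
      ... | no  γ≢α  | no  γ≢β  = x , r≡ , exchange-other γ≢α γ≢β cx≡γ

      -- Let `x` and `y` be the edges of colours α and β found at `u`. If `left x` is in `Z`, then
      -- `x` becomes β and a preceding β-edge at `u` becomes α. If not, `x` keeps α, and `left y` is
      -- outside `Z` too, since a step leads from it to `left x`; so `y` keeps β.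
      complete-mono : ∀ u → Complete c u → Complete exchange u
      complete-mono u full γ with full α | full β | C.decEq γ α | C.decEq γ β
      ... | _ | _ | no γ≢α | no γ≢β with x , r≡ , cx≡γ ← full γ = x , r≡ , exchange-other γ≢α γ≢β cx≡γ
      ... | x , rx≡u , cx≡α | y , ry≡u , cy≡β | yes refl | _ with Z? (left x)
      ...   | no x∉Z = x , rx≡u , exchange-out x∉Z cx≡α
      ...   | yes x∈Z with preceded cx≡α x∈Z
      -- Here `x` is `x₀`, so `u` is `v`, where the β-edge `y` cannot exist.
      ...     | inj₁ refl = contradiction (y , trans ry≡u (trans (sym rx≡u) right-x₀) , cy≡β) missing
      ...     | inj₂ (y′ , r≡ , cy′≡β , z) = y′ , trans r≡ rx≡u , trans (exchange-in z cy′≡β) (swap-right α β)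
      complete-mono u full γ | x , rx≡u , cx≡α | y , ry≡u , cy≡β | no _ | yes refl with Z? (left x)
      ...   | yes x∈Z = x , rx≡u , trans (exchange-in x∈Z cx≡α) (swap-left α β)
      ...   | no  x∉Z = y , ry≡u , exchange-out
        (λ z → x∉Z (z ◅◅ (y , x , refl , cy≡β , refl , cx≡α , trans rx≡u (sym ry≡u)) ◅ ε)) cy≡β

    result : ∃[ c′ ] (LeftProper c′ × Present c′ v β ×
                      (∀ γ → Present c v γ → Present c′ v γ) × (∀ u → Complete c u → Complete c′ u))
    result = exchange , exchange-proper , present-β , present-mono , complete-mono

  private
    -- If β is missing at `v`, the colours of the slots map `C` to itself without reaching β, so two
    -- slots share a colour; it is the α of the exchange.
    add-colour : ∀ {c} → LeftProper c → ∀ v β →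
      ∃[ c′ ] (LeftProper c′ × Present c′ v β ×
               (∀ γ → Present c v γ → Present c′ v γ) × (∀ u → Complete c u → Complete c′ u))
    add-colour {c} proper v β with X.any? (λ x → Finiteness.decEq R-finite (right x) v ×-dec C.decEq (c x) β)
    ... | yes present = c , proper , present , (λ _ → id) , (λ _ → id)
    ... | no  missing
      with γ , γ′ , γ≢γ′ , same ← C.collision (c ∘ slot v) β (λ γ eq → missing (slot v γ , right-slot v γ , eq))
      = Exchange.result proper missing (γ≢γ′ ∘ slot-injective v) (right-slot v γ) (right-slot v γ′) same

    State : Set a
    State = ∃ LeftProper

    complete-vertex : (s : State) → ∀ v →
      ∃[ s′ ] ((∀ u → Complete (proj₁ s) u → Complete (proj₁ s′) u) × Complete (proj₁ s′) v)
    complete-vertex s v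
      with s′ , (_ , mono) , full ← sweep
        (λ (c , _) (c′ , _) → (∀ γ → Present c v γ → Present c′ v γ) × (∀ u → Complete c u → Complete c′ u))
        ((λ _ → id) , (λ _ → id))
        (λ (f , g) (f′ , g′) → (λ γ → f′ γ ∘ f γ) , (λ u → g′ u ∘ g u))
        C-finite (λ (c , _) → Present c v) (λ γ (f , _) → f γ)
        (λ (c , proper) β → let c′ , proper′ , present , f , g = add-colour proper v β
                            in (c′ , proper′) , (f , g) , present)
        s
      = s′ , mono , full

  colouring : ∃ LeftProper → ∃[ c ] (LeftProper c × ∀ v → Complete c v)
  colouring s
    with (c , proper) , _ , full ← sweep
      (λ (c , _) (c′ , _) → ∀ u → Complete c u → Complete c′ u) (λ _ → id) (λ f f′ u → f′ u ∘ f u)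
      R-finite (λ (c , _) → Complete c) (λ u f → f u) complete-vertex s
    = c , proper , full

-- Straight-line programs

-- The coordinates written are kept apart from the functions that compute them, so that one word can
-- serve a family of maps. Projecting from `hs` instead of matching on it lets `exec w (hs b)`
-- unfold for a varying `b`.
exec : Vec (Fin n) m → Vec (Vec A n → A) m → Transformation A n
exec []      _  x = x
exec (i ∷ w) hs x = exec w (Vec.tail hs) (x [ i ]≔ Vec.head hs x)

exec-∷ʳ : ∀ (w : Vec (Fin n) m) i (hs : Vec (Vec A n → A) m) h x →
          exec (w ∷ʳ i) (hs ∷ʳ h) x ≡ exec w hs x [ i ]≔ h (exec w hs x)
exec-∷ʳ []      i []        h x = refl
exec-∷ʳ (j ∷ w) i (h′ ∷ hs) h x = exec-∷ʳ w i hs h (x [ j ]≔ h′ x)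

exec-untouched : ∀ (w : Vec (Fin n) m) (hs : Vec (Vec A n → A) m) {j} →
                 (∀ l → lookup w l ≢ j) → Trivial (exec w hs) j
exec-untouched []      hs j∉w x = refl
exec-untouched (i ∷ w) hs j∉w x =
  trans (exec-untouched w (Vec.tail hs) (j∉w ∘ suc) _) (Vec.lookup∘update′ (j∉w zero ∘ sym) x _)

-- The first coordinate selects among the programs `hs b`; the shifted word never writes to it.
fibrewise : (A → Vec (Vec A n → A) m) → Vec (Vec A (suc n) → A) m
fibrewise {m = zero}  hs = []
fibrewise {m = suc m} hs = (λ x → Vec.head (hs (Vec.head x)) (Vec.tail x)) ∷ fibrewise (Vec.tail ∘ hs)

exec-fibrewise : ∀ (w : Vec (Fin n) m) (hs : A → Vec (Vec A n → A) m) b x →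
                 exec (Vec.map suc w) (fibrewise hs) (b ∷ x) ≡ b ∷ exec w (hs b) x
exec-fibrewise []      hs b x = refl
exec-fibrewise (i ∷ w) hs b x = exec-fibrewise w (Vec.tail ∘ hs) b _

ComputableAlong : {A : Set a} → Vec (Fin n) m → Transformation A n → Set a
ComputableAlong w f = ∃[ hs ] exec w hs ≗ f

ComputableIn : {A : Set a} → ℕ → Transformation A n → Set a
ComputableIn m f = ∃[ w ] ComputableAlong {m = m} w f

assign : Fin n → (Vec A n → A) → Instruction A n
assign {n} {A = A} i h = g , λ j k j-nontrivial k-nontrivial → trans (only-i j j-nontrivial) (sym (only-i k k-nontrivial))
  where
  g : Transformation A n
  g x = x [ i ]≔ h x

  only-i : ∀ j → ¬ Trivial g j → j ≡ i
  only-i j nontrivial = decidable-stable (j Fin.≟ i) λ j≢i → nontrivial λ x → Vec.lookup∘update′ j≢i x (h x)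

toProgram : Vec (Fin n) m → Vec (Vec A n → A) m → Program A n
toProgram []      _  = []
toProgram (i ∷ w) hs = assign i (Vec.head hs) ∷ toProgram w (Vec.tail hs)

length-toProgram : ∀ (w : Vec (Fin n) m) (hs : Vec (Vec A n → A) m) → length (toProgram w hs) ≡ m
length-toProgram []      _  = refl
length-toProgram (_ ∷ w) hs = cong suc (length-toProgram w (Vec.tail hs))

run-toProgram : ∀ (w : Vec (Fin n) m) (hs : Vec (Vec A n → A) m) → run (toProgram w hs) ≗ exec w hs
run-toProgram []      _  x = refl
run-toProgram (_ ∷ w) hs x = run-toProgram w (Vec.tail hs) _

lookup-injective : {xs ys : Vec X n} → lookup xs ≗ lookup ys → xs ≡ ys
lookup-injective {xs = xs} {ys} eq =
  trans (sym (Vec.tabulate∘lookup xs)) (trans (Vec.tabulate-cong eq) (Vec.tabulate∘lookup ys))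

least : {P : ℕ → Set p} → Decidable P → P m → ∃[ k ] (k ≤ m × P k × ∀ j → P j → k ≤ j)
least {m = m} P? pm with P? zero
... | yes p₀ = zero , z≤n , p₀ , λ _ _ → z≤n
least {m = zero}  P? pm | no ¬p₀ = contradiction pm ¬p₀
least {m = suc m} P? pm | no ¬p₀ with k , k≤m , pk , min ← least (P? ∘ suc) pm =
  suc k , s≤s k≤m , pk , λ { zero p₀ → contradiction p₀ ¬p₀ ; (suc j) pj → s≤s (min j pj) }

-- Otherwise a choice of positions would inject `Fin n` into `Fin m`.
missed : m < n → (w : Vec (Fin n) m) → ∃[ j ] ∀ l → lookup w l ≢ j
missed {m} {n} m<n w with Fin.any? (λ j → Fin.all? (λ l → ¬? (lookup w l Fin.≟ j)))
... | yes found = found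
... | no  none  = contradiction (Fin.injective⇒≤ position-injective) (ℕ.<⇒≱ m<n)
  where
  hit : ∀ j → ∃[ l ] lookup w l ≡ j
  hit j = decidable-stable (Fin.any? (λ l → lookup w l Fin.≟ j)) λ unhit → none (j , λ l eq → unhit (l , eq))

  position-injective : Injective _≡_ _≡_ (proj₁ ∘ hit)
  position-injective {j} {k} eq = trans (sym (proj₂ (hit j))) (trans (cong (lookup w) eq) (proj₂ (hit k)))

run-++ : ∀ (p q : Program A n) → run (p ++ q) ≗ run q ∘ run p
run-++ []      q x = refl
run-++ (g ∷ p) q x = run-++ p q (proj₁ g x)

-- The upper bound

-- The word 0, 1, ..., n, ..., 1, 0. It does not depend on the map to be computed, so the inductive
-- programs for all colours can run as one.
palindrome : ∀ n → Vec (Fin (suc n)) (suc (n * 2))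
palindrome zero    = zero ∷ []
palindrome (suc n) = zero ∷ (Vec.map suc (palindrome n) ∷ʳ zero)

module _ {A : Set a} (A-finite : Finite A) where

  private
    module V {n} = Finiteness (Vec-finite A-finite n)

  abstract
    -- The edges at `v` are the preimages of the `γ ∷ v`. The colouring starts from `Vec.head`,
    -- which is proper on the left because head and tail determine a vector.
    tail-colouring : ∀ {f : Transformation A (suc n)} → Injective _≡_ _≡_ f →
      ∃ λ (c : Vec A (suc n) → A) →
        (∀ {x y} → Vec.tail x ≡ Vec.tail y → c x ≡ c y → x ≡ y) ×
        (∀ v γ → ∃[ x ] (Vec.tail (f x) ≡ v × c x ≡ γ))
    tail-colouring {n} {f} f-injective = colouring (Vec.head , λ { {_ ∷ _} {_ ∷ _} refl refl → refl })
      where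
      f⁻¹ : ∀ y → ∃[ x ] f x ≡ y
      f⁻¹ = V.injective⇒surjective f-injective

      edge-at : Vec A n → A → Vec A (suc n)
      edge-at v γ = proj₁ (f⁻¹ (γ ∷ v))

      f-edge-at : ∀ v γ → f (edge-at v γ) ≡ γ ∷ v
      f-edge-at v γ = proj₂ (f⁻¹ (γ ∷ v))

      open Colouring
        (Vec-finite A-finite (suc n)) (Vec-finite A-finite n) (Vec-finite A-finite n) A-finite
        Vec.tail (Vec.tail ∘ f) edge-at
        (λ v {γ} {γ′} eq → Vec.∷-injectiveˡ (trans (sym (f-edge-at v γ)) (trans (cong f eq) (f-edge-at v γ′))))
        (λ v γ → cong Vec.tail (f-edge-at v γ))

  computable-along-palindrome : ∀ n {f : Transformation A (suc n)} → Injective _≡_ _≡_ f →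
                                ComputableAlong (palindrome n) f
  computable-along-palindrome zero {f} _ = (Vec.head ∘ f) ∷ [] , λ { (b ∷ []) → singleton (f (b ∷ [])) }
    where
    singleton : (y : Vec A 1) → Vec.head y ∷ [] ≡ y
    singleton (_ ∷ []) = refl
  computable-along-palindrome (suc n) {f} f-injective = c ∷ (fibrewise hs ∷ʳ restore) , correct
    where
    ∃c : ∃ λ (c : Vec A (suc (suc n)) → A) →
         (∀ {x y} → Vec.tail x ≡ Vec.tail y → c x ≡ c y → x ≡ y) ×
         (∀ v γ → ∃[ x ] (Vec.tail (f x) ≡ v × c x ≡ γ))
    ∃c = tail-colouring f-injective

    c : Vec A (suc (suc n)) → A
    c = proj₁ ∃c

    -- The states before and after the middle instructions. Properness on the left makes `source`
    -- injective and completeness on the right makes `target` surjective, so both are bijective.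
    source target : Transformation A (suc (suc n))
    source x = c x ∷ Vec.tail x
    target x = c x ∷ Vec.tail (f x)

    source-injective : Injective _≡_ _≡_ source
    source-injective eq = proj₁ (proj₂ ∃c) (Vec.∷-injectiveʳ eq) (Vec.∷-injectiveˡ eq)

    target-surjective : ∀ y → ∃[ x ] target x ≡ y
    target-surjective (γ ∷ v) with x , right≡v , cx≡γ ← proj₂ (proj₂ ∃c) v γ = x , cong₂ _∷_ cx≡γ right≡v

    target-injective : Injective _≡_ _≡_ target
    target-injective = V.surjective⇒injective target-surjective

    source⁻¹ : ∀ y → ∃[ x ] source x ≡ y
    source⁻¹ = V.injective⇒surjective source-injective

    middle : A → Transformation A (suc n)
    middle b t = Vec.tail (f (proj₁ (source⁻¹ (b ∷ t))))

    -- The colour is `b` for both edges, so equal values give equal targets, hence the same edge and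
    -- the same tail.
    middle-injective : ∀ b → Injective _≡_ _≡_ (middle b)
    middle-injective b {t} {t′} eq =
      let x  , s  = source⁻¹ (b ∷ t)
          x′ , s′ = source⁻¹ (b ∷ t′)
          x≡x′    = target-injective (cong₂ _∷_ (trans (Vec.∷-injectiveˡ s) (sym (Vec.∷-injectiveˡ s′))) eq)
      in Vec.∷-injectiveʳ (trans (sym s) (trans (cong source x≡x′) s′))

    ∃hs : ∀ b → ComputableAlong (palindrome n) (middle b)
    ∃hs b = computable-along-palindrome n (middle-injective b)

    hs : A → Vec (Vec A (suc n) → A) (suc (n * 2))
    hs = proj₁ ∘ ∃hs

    -- As `target` is bijective, the first coordinate of `f x` is a function of `target x`.
    restore : Vec A (suc (suc n)) → A
    restore y = Vec.head (f (proj₁ (target-surjective y)))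

    middle-correct : ∀ x → exec (Vec.map suc (palindrome n)) (fibrewise hs) (source x) ≡ target x
    middle-correct x = begin
      exec (Vec.map suc (palindrome n)) (fibrewise hs) (source x) ≡⟨ exec-fibrewise (palindrome n) hs (c x) (Vec.tail x) ⟩
      c x ∷ exec (palindrome n) (hs (c x)) (Vec.tail x)           ≡⟨ cong (c x ∷_) (proj₂ (∃hs (c x)) (Vec.tail x)) ⟩
      c x ∷ Vec.tail (f (proj₁ (source⁻¹ (source x))))
        ≡⟨ cong (λ z → c x ∷ Vec.tail (f z)) (source-injective (proj₂ (source⁻¹ (source x)))) ⟩
      target x                                                    ∎
      where open ≡-Reasoning

    restore-correct : ∀ x → target x [ zero ]≔ restore (target x) ≡ f x
    restore-correct x = trans
      (cong (λ z → Vec.head (f z) ∷ Vec.tail (f x)) (target-injective (proj₂ (target-surjective (target x)))))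
      (head∷tail (f x))

    correct : exec (palindrome (suc n)) (c ∷ (fibrewise hs ∷ʳ restore)) ≗ f
    correct x@(_ ∷ _) = begin
      exec (Vec.map suc (palindrome n) ∷ʳ zero) (fibrewise hs ∷ʳ restore) (source x)
        ≡⟨ exec-∷ʳ (Vec.map suc (palindrome n)) zero (fibrewise hs) restore (source x) ⟩
      y [ zero ]≔ restore y
        ≡⟨ cong (λ y → y [ zero ]≔ restore y) (middle-correct x) ⟩
      target x [ zero ]≔ restore (target x)
        ≡⟨ restore-correct x ⟩
      f x ∎
      where
      open ≡-Reasoning
      y : Vec A (suc (suc n))
      y = exec (Vec.map suc (palindrome n)) (fibrewise hs) (source x)

  -- Existence of the procedural complexity

  -- The functions `Vec A n → A` are finitely many only up to pointwise equality, so the search runs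
  -- over their value tables.
  computableAlong? : ∀ (w : Vec (Fin n) m) (f : Transformation A n) → Dec (ComputableAlong w f)
  computableAlong? {n} {m} w f = map′
    (λ (ts , eq) → Vec.map fromTable ts , eq)
    (λ (hs , eq) → Vec.map toTable hs , λ x → trans (exec-tables w hs x) (eq x))
    (Finiteness.any? (Vec-finite (Vec-finite A-finite k) m)
      (λ ts → V.all? (λ x → V.decEq (exec w (Vec.map fromTable ts) x) (f x))))
    where
    k : ℕ
    k = proj₁ (Vec-finite A-finite n)

    open Inverse (proj₂ (Vec-finite A-finite n))

    toTable : (Vec A n → A) → Vec A k
    toTable h = Vec.tabulate (h ∘ from)

    fromTable : Vec A k → Vec A n → A
    fromTable t x = lookup t (to x)

    table-correct : ∀ h → fromTable (toTable h) ≗ h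
    table-correct h x = trans (Vec.lookup∘tabulate (h ∘ from) (to x)) (cong h (strictlyInverseʳ x))

    exec-tables : ∀ {m} (w : Vec (Fin n) m) hs → exec w (Vec.map fromTable (Vec.map toTable hs)) ≗ exec w hs
    exec-tables []      hs       x = refl
    exec-tables (i ∷ w) (h ∷ hs) x =
      trans (exec-tables w hs _) (cong (λ b → exec w hs (x [ i ]≔ b)) (table-correct h x))

  computableIn? : ∀ (f : Transformation A n) m → Dec (ComputableIn m f)
  computableIn? f m = Finiteness.any? (Vec-finite Fin-finite m) (λ w → computableAlong? w f)

  target-coordinate : (g : Instruction A (suc n)) → ∃[ i ] ∀ j → j ≢ i → Trivial (proj₁ g) j
  target-coordinate {n} (g , g-instruction) = choose (Fin.any? (¬? ∘ trivial?))
    where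
    trivial? : ∀ i → Dec (Trivial g i)
    trivial? i = V.all? (λ x → Finiteness.decEq A-finite (lookup (g x) i) (lookup x i))

    choose : Dec (∃[ i ] ¬ Trivial g i) → ∃[ i ] ∀ j → j ≢ i → Trivial g j
    choose (yes (i , i-nontrivial)) = i , λ j j≢i →
      decidable-stable (trivial? j) λ j-nontrivial → j≢i (g-instruction j i j-nontrivial i-nontrivial)
    -- If every coordinate is trivial, any coordinate can serve as the target.
    choose (no none) = zero , λ j _ → decidable-stable (trivial? j) λ j-nontrivial → none (j , j-nontrivial)

  -- An instruction is an assignment to its target coordinate, so the search for a least word in
  -- `complexity` accounts for arbitrary programs.
  run-computable : (p : Program A (suc n)) → ComputableIn (length p) (run p)
  run-computable []      = [] , [] , λ _ → refl
  run-computable (g ∷ p) with i , others ← target-coordinate g | w , hs , eq ← run-computable p =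
    i ∷ w , coordinate (proj₁ g) i ∷ hs , λ x → trans (cong (exec w hs) (lookup-injective (step x))) (eq (proj₁ g x))
    where
    step : ∀ x → lookup (x [ i ]≔ lookup (proj₁ g x) i) ≗ lookup (proj₁ g x)
    step x j with j Fin.≟ i
    ... | yes refl = Vec.lookup∘update i x _
    ... | no  j≢i  = trans (Vec.lookup∘update′ j≢i x _) (sym (others j j≢i x))

  -- At most `n` instructions cannot write to all `suc n` coordinates.
  short-program-trivial : (p : Program A (suc n)) → length p ≤ n → ∃[ j ] Trivial (run p) j
  short-program-trivial p short
    with w , hs , eq ← run-computable p
    with j , j∉w ← missed (s≤s short) w
    = j , λ x → trans (cong (λ y → lookup y j) (sym (eq x))) (exec-untouched w hs j∉w x)

  complexity : ∀ {f : Transformation A (suc n)} → ComputableIn m f → ∃[ L ] (ProceduralComplexity f L × L ≤ m)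
  complexity {f = f} computable
    with L , L≤m , (w , hs , eq) , min ← least (computableIn? f) computable
    = L , ( (toProgram w hs , (λ x → trans (run-toProgram w hs x) (eq x)) , length-toProgram w hs)
          , λ p computes → min (length p) (let w′ , hs′ , eq′ = run-computable p
                                           in w′ , hs′ , λ x → trans (eq′ x) (computes x)))
      , L≤m

  -- The lower bound

  module Lower {o e : A} (o≢e : o ≢ e) (n : ℕ) where

    open Transposition (V.decEq {suc n})

    zeros ones : Vec A (suc n)
    zeros = replicate (suc n) o
    ones  = replicate (suc n) e

    transposition : Transformation A (suc n)
    transposition = swap zeros ones

    private
      lookup-ones : ∀ i → lookup ones i ≢ o
      lookup-ones i eq = o≢e (trans (sym eq) (Vec.lookup-replicate i e))

    transposition-permutation : IsPermutation transposition
    transposition-permutation = swap-injective zeros ones ,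
      λ y → transposition y , λ { refl → swap-involutive zeros ones y }

    -- With S = {x | xᵢ = xⱼ = o}, the inverse of g would map S injectively into S ∖ {zeros}.
    no-intermediate : ∀ {g : Transformation A (suc n)} {i j} → Injective _≡_ _≡_ g → Trivial g j →
                      ¬ (∀ x → lookup (g x) i ≡ lookup (transposition x) i)
    no-intermediate {g} {i} {j} g-injective gⱼ gᵢ = avoids-zeros (V.injective⇒surjective retract-injective zeros)
      where
      S : Vec A (suc n) → Set a
      S x = lookup x i ≡ o × lookup x j ≡ o

      S? : Decidable S
      S? x = Finiteness.decEq A-finite _ _ ×-dec Finiteness.decEq A-finite _ _

      -- The transposition sends `zeros` to `ones`, whose coordinate `i` is not `o`, so `x` is not
      -- `zeros`. As `x` has `o` at `j`, it is not `ones` either. Hence `x` is fixed by the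
      -- transposition and its coordinate `i` is that of `g x`.
      S-pullback : ∀ x → S (g x) → S x × x ≢ zeros
      S-pullback x (gxᵢ≡o , gxⱼ≡o) = (xᵢ≡o , xⱼ≡o) , x≢zeros
        where
        fxᵢ≡o : lookup (transposition x) i ≡ o
        fxᵢ≡o = trans (sym (gᵢ x)) gxᵢ≡o

        xⱼ≡o : lookup x j ≡ o
        xⱼ≡o = trans (sym (gⱼ x)) gxⱼ≡o

        x≢zeros : x ≢ zeros
        x≢zeros refl = lookup-ones i (trans (cong (λ y → lookup y i) (sym (swap-left zeros ones))) fxᵢ≡o)

        x≢ones : x ≢ ones
        x≢ones refl = lookup-ones j xⱼ≡o

        xᵢ≡o : lookup x i ≡ o
        xᵢ≡o = trans (cong (λ y → lookup y i) (sym (swap-other x≢zeros x≢ones))) fxᵢ≡o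

      g⁻¹ : ∀ y → ∃[ x ] g x ≡ y
      g⁻¹ = V.injective⇒surjective g-injective

      g⁻¹-S : ∀ {y} → S y → S (proj₁ (g⁻¹ y)) × proj₁ (g⁻¹ y) ≢ zeros
      g⁻¹-S {y} Sy = S-pullback (proj₁ (g⁻¹ y)) (subst S (sym (proj₂ (g⁻¹ y))) Sy)

      -- The inverse of `g` on `S`, extended by the identity. It is an injective self-map of a
      -- finite set that misses `zeros`.
      retract : Transformation A (suc n)
      retract y with S? y
      ... | yes _ = proj₁ (g⁻¹ y)
      ... | no  _ = y

      retract-injective : Injective _≡_ _≡_ retract
      retract-injective {x} {y} eq with S? x | S? y
      ... | yes _  | yes _  = trans (sym (proj₂ (g⁻¹ x))) (trans (cong g eq) (proj₂ (g⁻¹ y)))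
      ... | yes Sx | no ¬Sy = contradiction (subst S eq (proj₁ (g⁻¹-S Sx))) ¬Sy
      ... | no ¬Sx | yes Sy = contradiction (subst S (sym eq) (proj₁ (g⁻¹-S Sy))) ¬Sx
      ... | no _   | no _   = eq

      avoids-zeros : ¬ (∃[ y ] retract y ≡ zeros)
      avoids-zeros (y , eq) with S? y
      ... | yes Sy = proj₂ (g⁻¹-S Sy) eq
      ... | no ¬Sy = ¬Sy (subst S (sym eq) (Vec.lookup-replicate i o , Vec.lookup-replicate j o))

    transposition-lower-bound : (p : Program A (suc n)) → Computes p transposition → n + n < length p
    transposition-lower-bound p computes with ℕ.<-≤-connex (n + n) (length p)
    ... | inj₁ long  = long
    ... | inj₂ short = contradiction run-u-i (no-intermediate run-u-injective (proj₂ u-trivial))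
      where
      -- As `length p ≤ n + n`, both parts have at most `n` instructions, one fewer than there are
      -- coordinates.
      u v : Program A (suc n)
      u = take n p
      v = drop n p

      factor : ∀ x → run v (run u x) ≡ transposition x
      factor x = begin
        run v (run u x) ≡⟨ run-++ u v x ⟨
        run (u ++ v) x  ≡⟨ cong (λ r → run r x) (List.take++drop≡id n p) ⟩
        run p x         ≡⟨ computes x ⟩
        transposition x ∎
        where open ≡-Reasoning

      u-trivial : ∃[ j ] Trivial (run u) j
      u-trivial = short-program-trivial u
        (ℕ.≤-trans (ℕ.≤-reflexive (List.length-take n p)) (ℕ.m⊓n≤m n (length p)))

      v-trivial : ∃[ i ] Trivial (run v) i
      v-trivial = short-program-trivial v
        (ℕ.≤-trans (ℕ.≤-reflexive (List.length-drop n p)) (ℕ.m≤n+o⇒m∸n≤o (length p) n short))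

      run-u-injective : Injective _≡_ _≡_ (run u)
      run-u-injective {x} {y} eq = swap-injective zeros ones
        (trans (sym (factor x)) (trans (cong (run v) eq) (factor y)))

      run-u-i : ∀ x → lookup (run u x) (proj₁ v-trivial) ≡ lookup (transposition x) (proj₁ v-trivial)
      run-u-i x = trans (sym (proj₂ v-trivial (run u x))) (cong (λ y → lookup y (proj₁ v-trivial)) (factor x))

-- The exact maximum

maximal⇒exact : {f : Transformation A n} → ∃[ L ] (ProceduralComplexity f L × L ≤ m) →
                (∀ p → Computes p f → m ≤ length p) → ProceduralComplexity f m
maximal⇒exact (L , ((p , computes , refl) , _) , L≤m) lower =
  (p , computes , ℕ.≤-antisym L≤m (lower p computes)) , lower

theorem2 : {a : Level} (A : Set a) (q n : ℕ) → A ↔ Fin q → 2 ≤ q → 2 ≤ n →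
    MaxComplexityOfPermutations A n (2 * n ∸ 1)
theorem2 A (suc (suc q)) (suc n) e (s≤s (s≤s z≤n)) _ = upper , transposition , transposition-permutation , sharp
  where
  A-finite : Finite A
  A-finite = suc (suc q) , e

  -- There are `suc n` coordinates from here on, so the bound is `suc (n + n)` for the transposition
  -- and `suc (n * 2)` for the palindrome.
  2n∸1≡ : 2 * suc n ∸ 1 ≡ suc (n + n)
  2n∸1≡ = trans (cong (n +_) (cong suc (ℕ.+-identityʳ n))) (ℕ.+-suc n n)

  n*2≡ : suc (n * 2) ≡ 2 * suc n ∸ 1
  n*2≡ = trans (cong suc (trans (ℕ.*-comm n 2) (cong (n +_) (ℕ.+-identityʳ n)))) (sym 2n∸1≡)

  upper : ∀ f → IsPermutation f → ∃[ L ] (ProceduralComplexity f L × L ≤ 2 * suc n ∸ 1)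
  upper f (f-injective , _) = complexity A-finite
    (subst (λ m → ComputableIn m f) n*2≡ (palindrome n , computable-along-palindrome A-finite n f-injective))

  0≢1 : Inverse.from e zero ≢ Inverse.from e (suc zero)
  0≢1 eq with trans (sym (Inverse.strictlyInverseˡ e zero))
                    (trans (cong (Inverse.to e) eq) (Inverse.strictlyInverseˡ e (suc zero)))
  ... | ()

  open Lower A-finite 0≢1 n

  lower : ∀ p → Computes p transposition → 2 * suc n ∸ 1 ≤ length p
  lower p computes = subst (_≤ length p) (sym 2n∸1≡) (transposition-lower-bound p computes)

  sharp : ProceduralComplexity transposition (2 * suc n ∸ 1)
  sharp = maximal⇒exact (upper transposition transposition-permutation) lower
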